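{- Let $G_1$ and $G_2$ be graphs which both admit a perfect matching, let $e_1\in E(G_1)$ and $e_2\in E(G_2)$, and let $G=G_1(e_1)\#G_2(e_2)$ be a graph obtained by applying a 2-cut connection on $e_1$ and $e_2$. Then $G$ is PMH if and only if, for each $i\in\{1,2\}$, every perfect matching of $G_i$ can be extended to a Hamiltonian cycle of $G_i$ which contains $e_i$.
   Context: The graphs $G_1,G_2$ are finite and connected, may have multiple (parallel) edges, and have no loops; they need not be regular. A perfect matching is the edge set of a $1$-regular spanning subgraph, and a Hamiltonian cycle is a connected $2$-regular spanning subgraph (so two parallel edges form a Hamiltonian cycle of a graph on two vertices). A perfect matching $M$ can be extended to a Hamiltonian cycle $H$ if $M\subseteq E(H)$. A graph admitting a perfect matching is PMH if each of its perfect matchings can be extended to a Hamiltonian cycle. 2-cut connection: let $e_1=x_1y_1\in E(G_1)$ and $e_2=x_2y_2\in E(G_2)$, with $G_1,G_2$ vertex-disjoint. A 2-cut connection on $e_1$ and $e_2$ is the graph $(G_1-e_1)\cup(G_2-e_2)\cup\{x_1x_2,y_1y_2\}$; $G_1(e_1)\#G_2(e_2)$ denotes either this graph or the one obtained by swapping the roles of $x_2$ and $y_2$. -}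

module Defs where

open import Data.Bool.Base using (_∨_)
open import Data.Fin.Base using (Fin; zero; suc; splitAt; punchIn; _↑ˡ_; _↑ʳ_)
open import Data.Fin.Properties
  using (_≟_; ↑ˡ-injective; ↑ʳ-injective; splitAt-↑ˡ; splitAt-↑ʳ)
open import Data.Fin.Subset using (Subset; _∈_; _⊆_; _∩_; ∣_∣; ⊤)
open import Data.Nat.Base using (ℕ; suc; _+_)
open import Data.Product.Base using (_×_; _,_; ∃; ∃-syntax; proj₁; proj₂)
import Data.Product.Base as Product
open import Data.Sum.Base using (_⊎_; inj₁; inj₂; [_,_]′)
open import Data.Vec.Base using (tabulate)
open import Function.Base using (_∘_)
open import Relation.Binary.Construct.Closure.ReflexiveTransitive using (Star)
open import Relation.Binary.PropositionalEquality using (_≡_; _≢_; sym; trans; cong)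
open import Relation.Nullary.Decidable using (⌊_⌋)

-- A finite loopless multigraph with vertex set Fin n and edge set Fin m.
-- Edges are undirected: the order of the pair `ends e` carries no meaning, and
-- `Joins` is the symmetric incidence relation.  Parallel edges are distinct
-- elements of Fin m with the same ends.
record Graph (n m : ℕ) : Set where
  field
    ends     : Fin m → Fin n × Fin n
    loopless : ∀ e → proj₁ (ends e) ≢ proj₂ (ends e)

open Graph public

private
  variable
    n m n₁ m₁ n₂ m₂ : ℕ

Joins : Graph n m → Fin m → Fin n → Fin n → Set
Joins G e x y = ends G e ≡ (x , y) ⊎ ends G e ≡ (y , x)

incident : Graph n m → Fin n → Subset m
incident G v = tabulate λ e → ⌊ proj₁ (ends G e) ≟ v ⌋ ∨ ⌊ proj₂ (ends G e) ≟ v ⌋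

-- An edge set S : Subset m stands for the spanning subgraph with all n vertices
-- and edge set S.

degree : Graph n m → Subset m → Fin n → ℕ
degree G S v = ∣ S ∩ incident G v ∣

Regular : ℕ → Graph n m → Subset m → Set
Regular k G S = ∀ v → degree G S v ≡ k

Adjacent : Graph n m → Subset m → Fin n → Fin n → Set
Adjacent G S u v = ∃[ e ] (e ∈ S × Joins G e u v)

ConnectedOn : Graph n m → Subset m → Set
ConnectedOn G S = ∀ u v → Star (Adjacent G S) u v

Connected : Graph n m → Set
Connected G = ConnectedOn G ⊤

PerfectMatching : Graph n m → Subset m → Set
PerfectMatching = Regular 1

HamiltonianCycle : Graph n m → Subset m → Set
HamiltonianCycle G H = ConnectedOn G H × Regular 2 G H

HasPerfectMatching : Graph n m → Set
HasPerfectMatching G = ∃ (PerfectMatching G)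

PMH : Graph n m → Set
PMH G = HasPerfectMatching G ×
  (∀ M → PerfectMatching G M → ∃[ H ] (HamiltonianCycle G H × M ⊆ H))

PMsExtendThrough : (G : Graph n m) → Fin m → Set
PMsExtendThrough G e =
  ∀ M → PerfectMatching G M → ∃[ H ] (HamiltonianCycle G H × M ⊆ H × e ∈ H)

-- The remaining edges are renumbered: edge i of G ─ e is edge punchIn e i of G.
_─_ : Graph n (suc m) → Fin (suc m) → Graph n m
ends     (G ─ e) = ends G ∘ punchIn e
loopless (G ─ e) = loopless G ∘ punchIn e

_⊔_ : Graph n₁ m₁ → Graph n₂ m₂ → Graph (n₁ + n₂) (m₁ + m₂)
ends (_⊔_ {n₁} {m₁} {n₂} G₁ G₂) e =
  [ Product.map (_↑ˡ n₂) (_↑ˡ n₂) ∘ ends G₁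
  , Product.map (n₁ ↑ʳ_) (n₁ ↑ʳ_) ∘ ends G₂
  ]′ (splitAt m₁ e)
loopless (_⊔_ {n₁} {m₁} {n₂} G₁ G₂) e with splitAt m₁ e
... | inj₁ i = loopless G₁ i ∘ ↑ˡ-injective n₂ _ _
... | inj₂ j = loopless G₂ j ∘ ↑ʳ-injective n₁ _ _

addEdge : (x y : Fin n) → x ≢ y → Graph n m → Graph n (suc m)
ends     (addEdge x y x≢y G) zero    = x , y
ends     (addEdge x y x≢y G) (suc e) = ends G e
loopless (addEdge x y x≢y G) zero    = x≢y
loopless (addEdge x y x≢y G) (suc e) = loopless G e

↑ˡ≢↑ʳ : (i : Fin n₁) (j : Fin n₂) → i ↑ˡ n₂ ≢ n₁ ↑ʳ j
↑ˡ≢↑ʳ {n₁} {n₂} i j eq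
  with () ← trans (sym (splitAt-↑ˡ n₁ i n₂))
                  (trans (cong (splitAt n₁) eq) (splitAt-↑ʳ n₁ n₂ j))

-- (G₁ − e₁) ∪ (G₂ − e₂) ∪ {x₁x₂, y₁y₂}, intended for e₁ = x₁y₁ and e₂ = x₂y₂.
-- As edges are undirected, the variant with x₂ and y₂ swapped is the instance
-- at y₂ x₂ in place of x₂ y₂.
twoCutConnection :
  (G₁ : Graph n₁ (suc m₁)) (e₁ : Fin (suc m₁)) (x₁ y₁ : Fin n₁)
  (G₂ : Graph n₂ (suc m₂)) (e₂ : Fin (suc m₂)) (x₂ y₂ : Fin n₂) →
  Graph (n₁ + n₂) (2 + (m₁ + m₂))
twoCutConnection {n₁} {n₂ = n₂} G₁ e₁ x₁ y₁ G₂ e₂ x₂ y₂ =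
  addEdge (x₁ ↑ˡ n₂) (n₁ ↑ʳ x₂) (↑ˡ≢↑ʳ x₁ x₂)
    (addEdge (y₁ ↑ˡ n₂) (n₁ ↑ʳ y₂) (↑ˡ≢↑ʳ y₁ y₂)
      ((G₁ ─ e₁) ⊔ (G₂ ─ e₂)))

{-# OPTIONS --safe #-}
-- By the handshake lemma, a k-regular spanning subgraph meets a cut in an even number of edges when
-- k is even or the shores have even order.  As G₁ has a perfect matching, its order is even, so
-- perfect matchings and Hamiltonian cycles of G use both edges of the 2-cut or neither (both, for a
-- Hamiltonian cycle, by connectedness).  Replacing the two cut edges by e₁ and e₂ therefore turns
-- them into pairs of such subgraphs of G₁ and G₂ that agree on e₁ and e₂.  Pairs of Hamiltonian
-- cycles through e₁ and e₂ glue back since a cycle minus an edge is connected.  In a Hamiltonian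
-- cycle the complement of a perfect matching is one too, so either trace on the cut can be
-- prescribed.
module Submission where

open import Defs
open import Algebra.Bundles using (CommutativeMonoid; CommutativeRing; Monoid)
import Algebra.Properties.CommutativeMonoid.Sum as CommutativeMonoidSum
import Algebra.Properties.Monoid.Sum as MonoidSum
import Algebra.Properties.Semiring.Sum as SemiringSum
open import Data.Bool.Base using (Bool; true; false; not; _∧_; _∨_; _xor_; if_then_else_)
open import Data.Bool.Properties
  using (xor-∧-commutativeRing; xor-identityʳ; ∧-zeroʳ; ∧-identityʳ; ∨-comm; ∨-identityʳ)
import Data.Bool.Properties as Bool
open import Data.Fin.Base using (Fin; zero; suc; splitAt; punchIn; punchOut; _↑ˡ_; _↑ʳ_)
open import Data.Fin.Properties
  using (_≟_; punchIn-punchOut; punchInᵢ≢i; ↑ˡ-injective; ↑ʳ-injective;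
         splitAt-↑ˡ; splitAt-↑ʳ; splitAt⁻¹-↑ˡ; splitAt⁻¹-↑ʳ)
open import Data.Fin.Subset using (Subset; _∈_; _⊆_; _∩_; ∁; ∣_∣)
open import Data.Nat.Base using (ℕ; zero; suc; _+_)
open import Data.Nat.Properties
  using (+-0-commutativeMonoid; +-identityʳ; +-assoc; +-cancelʳ-≡)
open import Data.Product.Base using (_×_; _,_; ∃; ∃-syntax; proj₁; proj₂)
import Data.Product.Base as Product
open import Data.Sum.Base using (_⊎_; inj₁; inj₂; [_,_]′)
import Data.Sum.Base as Sum
open import Data.Vec.Base using (lookup; tabulate; insertAt; _∷_; []; _++_)
open import Data.Vec.Properties
  using ([]=⇒lookup; lookup⇒[]=; lookup-zipWith; lookup-map; lookup∘tabulate;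
         lookup-++ˡ; lookup-++ʳ; insertAt-lookup; insertAt-punchIn)
open import Function.Base using (_∘_; const; id)
open import Function.Bundles using (_⇔_; mk⇔)
open import Relation.Binary.Construct.Closure.ReflexiveTransitive
  using (Star; ε; _◅_; _◅◅_; gmap; reverse)
open import Relation.Binary.PropositionalEquality
  using (_≡_; _≢_; refl; sym; trans; cong; cong₂; subst; module ≡-Reasoning)
open import Relation.Nullary.Decidable using (yes; no; ⌊_⌋)
open import Relation.Nullary.Negation using (contradiction)

open CommutativeMonoidSum +-0-commutativeMonoid
  using (sum; sum-cong-≗; sum-remove; sum-replicate-zero; ∑-distrib-+)
module Xor = SemiringSum (CommutativeRing.semiring xor-∧-commutativeRing)

private
  variable
    n m n₁ m₁ n₂ m₂ N K k : ℕ

-- Indicators, finite sums and parity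

♯ : Bool → ℕ
♯ b = if b then 1 else 0

odd : ℕ → Bool
odd zero    = false
odd (suc n) = not (odd n)

⌊≟⌋-refl : (a : Fin n) → ⌊ a ≟ a ⌋ ≡ true
⌊≟⌋-refl a with a ≟ a
... | yes _   = refl
... | no a≢a = contradiction refl a≢a

⌊≟⌋-≢ : {a b : Fin n} → a ≢ b → ⌊ a ≟ b ⌋ ≡ false
⌊≟⌋-≢ {a = a} {b} a≢b with a ≟ b
... | yes a≡b = contradiction a≡b a≢b
... | no _    = refl

⌊≟⌋-injective : (f : Fin n → Fin N) → (∀ {a b} → f a ≡ f b → a ≡ b) →
                ∀ a b → ⌊ f a ≟ f b ⌋ ≡ ⌊ a ≟ b ⌋
⌊≟⌋-injective f inj a b with a ≟ b
... | yes refl = ⌊≟⌋-refl (f a)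
... | no a≢b   = ⌊≟⌋-≢ (a≢b ∘ inj)

module _ {c ℓ} (M : Monoid c ℓ) where
  open Monoid M renaming (refl to ≈-refl; sym to ≈-sym; trans to ≈-trans)
  private module Σ = MonoidSum M

  -- Kept general in the monoid because it serves both degree sums in the naturals and parity sums
  -- under `xor`.
  sum-splitAt : ∀ m (t : Fin (m + n) → Carrier) →
                Σ.sum t ≈ Σ.sum (t ∘ (_↑ˡ n)) ∙ Σ.sum (t ∘ (m ↑ʳ_))
  sum-splitAt zero    t = ≈-sym (identityˡ _)
  sum-splitAt (suc m) t =
    ≈-trans (∙-cong ≈-refl (sum-splitAt m (t ∘ suc))) (≈-sym (assoc _ _ _))

xor-sum-indicator : (f : Fin n → Bool) (a : Fin n) →
                    Xor.sum (λ v → f v ∧ ⌊ a ≟ v ⌋) ≡ f a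
xor-sum-indicator {suc n} f a = begin
  Xor.sum (λ v → f v ∧ ⌊ a ≟ v ⌋)
    ≡⟨ Xor.sum-remove {i = a} (λ v → f v ∧ ⌊ a ≟ v ⌋) ⟩
  (f a ∧ ⌊ a ≟ a ⌋) xor Xor.sum (λ i → f (punchIn a i) ∧ ⌊ a ≟ punchIn a i ⌋)
    ≡⟨ cong₂ _xor_ (trans (cong (f a ∧_) (⌊≟⌋-refl a)) (∧-identityʳ (f a)))
         (trans (Xor.sum-cong-≗ λ i →
                   trans (cong (f (punchIn a i) ∧_) (⌊≟⌋-≢ (punchInᵢ≢i a i ∘ sym)))
                         (∧-zeroʳ (f (punchIn a i))))
                (Xor.sum-replicate-zero n)) ⟩
  f a xor false
    ≡⟨ xor-identityʳ (f a) ⟩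
  f a ∎
  where open ≡-Reasoning

xor-sum-true⇒∃ : (t : Fin n → Bool) → Xor.sum t ≡ true → ∃[ i ] t i ≡ true
xor-sum-true⇒∃ {suc n} t eq with t zero in t₀
... | true  = zero , t₀
... | false = Product.map suc id (xor-sum-true⇒∃ (t ∘ suc) eq)

∣p∣≡sum : (p : Subset m) → ∣ p ∣ ≡ sum (♯ ∘ lookup p)
∣p∣≡sum []          = refl
∣p∣≡sum (true ∷ p)  = cong suc (∣p∣≡sum p)
∣p∣≡sum (false ∷ p) = ∣p∣≡sum p

odd-∣p∣ : (p : Subset m) → odd ∣ p ∣ ≡ Xor.sum (lookup p)
odd-∣p∣ []          = refl
odd-∣p∣ (true ∷ p)  = cong not (odd-∣p∣ p)
odd-∣p∣ (false ∷ p) = odd-∣p∣ p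

-- Degrees and cuts

meets : Fin n × Fin n → Fin n → Bool
meets (a , b) v = ⌊ a ≟ v ⌋ ∨ ⌊ b ≟ v ⌋

lookup-∩-incident : (G : Graph n m) (S : Subset m) (v : Fin n) (e : Fin m) →
                    lookup (S ∩ incident G v) e ≡ lookup S e ∧ meets (ends G e) v
lookup-∩-incident G S v e =
  trans (lookup-zipWith _∧_ e S (incident G v))
        (cong (lookup S e ∧_) (lookup∘tabulate _ e))

degree-sum : (G : Graph n m) (S : Subset m) (v : Fin n) →
             degree G S v ≡ sum (λ e → ♯ (lookup S e ∧ meets (ends G e) v))
degree-sum G S v =
  trans (∣p∣≡sum (S ∩ incident G v)) (sum-cong-≗ λ e → cong ♯ (lookup-∩-incident G S v e))

odd-degree : (G : Graph n m) (S : Subset m) (v : Fin n) →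
             odd (degree G S v) ≡ Xor.sum (λ e → lookup S e ∧ meets (ends G e) v)
odd-degree G S v =
  trans (odd-∣p∣ (S ∩ incident G v)) (Xor.sum-cong-≗ λ e → lookup-∩-incident G S v e)

crosses : Graph n m → (Fin n → Bool) → Fin m → Bool
crosses G f e = f (proj₁ (ends G e)) xor f (proj₂ (ends G e))

-- As the two ends differ, no vertex satisfies both disjuncts of `meets`; so `∨` may be replaced by
-- `xor`, and the sum splits into two indicator sums.
xor-sum-meets : (f : Fin n → Bool) {a b : Fin n} → a ≢ b →
                Xor.sum (λ v → f v ∧ meets (a , b) v) ≡ f a xor f b
xor-sum-meets f {a} {b} a≢b = begin
  Xor.sum (λ v → f v ∧ meets (a , b) v)
    ≡⟨ Xor.sum-cong-≗ pointwise ⟩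
  Xor.sum (λ v → (f v ∧ ⌊ a ≟ v ⌋) xor (f v ∧ ⌊ b ≟ v ⌋))
    ≡⟨ Xor.∑-distrib-+ (λ v → f v ∧ ⌊ a ≟ v ⌋) (λ v → f v ∧ ⌊ b ≟ v ⌋) ⟩
  Xor.sum (λ v → f v ∧ ⌊ a ≟ v ⌋) xor Xor.sum (λ v → f v ∧ ⌊ b ≟ v ⌋)
    ≡⟨ cong₂ _xor_ (xor-sum-indicator f a) (xor-sum-indicator f b) ⟩
  f a xor f b ∎
  where
  open ≡-Reasoning
  pointwise : ∀ v → f v ∧ meets (a , b) v ≡ (f v ∧ ⌊ a ≟ v ⌋) xor (f v ∧ ⌊ b ≟ v ⌋)
  pointwise v with f v | a ≟ v | b ≟ v
  ... | false | _        | _        = refl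
  ... | true  | yes refl | yes refl = contradiction refl a≢b
  ... | true  | yes _    | no _     = refl
  ... | true  | no _     | yes _    = refl
  ... | true  | no _     | no _     = refl

-- The handshake lemma modulo 2, weighted by the indicator function f of one shore of the cut.
cut-parity : (G : Graph n m) (S : Subset m) (f : Fin n → Bool) →
             Xor.sum (λ v → f v ∧ odd (degree G S v)) ≡
             Xor.sum (λ e → lookup S e ∧ crosses G f e)
cut-parity {n} {m} G S f = begin
  Xor.sum (λ v → f v ∧ odd (degree G S v))
    ≡⟨ Xor.sum-cong-≗ (λ v → trans (cong (f v ∧_) (odd-degree G S v))
                                   (Xor.*-distribˡ-sum (f v) (λ e → lookup S e ∧ meets (ends G e) v))) ⟩
  Xor.sum (λ v → Xor.sum (λ e → f v ∧ (lookup S e ∧ meets (ends G e) v)))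
    ≡⟨ Xor.∑-comm (λ v e → f v ∧ (lookup S e ∧ meets (ends G e) v)) ⟩
  Xor.sum (λ e → Xor.sum (λ v → f v ∧ (lookup S e ∧ meets (ends G e) v)))
    ≡⟨ Xor.sum-cong-≗ (λ e → begin
         Xor.sum (λ v → f v ∧ (lookup S e ∧ meets (ends G e) v))
           ≡⟨ Xor.sum-cong-≗ (λ v → ∧-left-comm (f v) (lookup S e) _) ⟩
         Xor.sum (λ v → lookup S e ∧ (f v ∧ meets (ends G e) v))
           ≡⟨ sym (Xor.*-distribˡ-sum (lookup S e) (λ v → f v ∧ meets (ends G e) v)) ⟩
         lookup S e ∧ Xor.sum (λ v → f v ∧ meets (ends G e) v)
           ≡⟨ cong (lookup S e ∧_) (xor-sum-meets f (loopless G e)) ⟩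
         lookup S e ∧ crosses G f e ∎) ⟩
  Xor.sum (λ e → lookup S e ∧ crosses G f e) ∎
  where
  open ≡-Reasoning
  ∧-left-comm : ∀ a b c → a ∧ (b ∧ c) ≡ b ∧ (a ∧ c)
  ∧-left-comm true  b     c = refl
  ∧-left-comm false true  c = refl
  ∧-left-comm false false c = refl

regular-cut-parity : (G : Graph n m) (S : Subset m) → Regular k G S → (f : Fin n → Bool) →
                     Xor.sum (λ v → f v ∧ odd k) ≡ Xor.sum (λ e → lookup S e ∧ crosses G f e)
regular-cut-parity G S reg f =
  trans (Xor.sum-cong-≗ λ v → cong (λ d → f v ∧ odd d) (sym (reg v))) (cut-parity G S f)

-- Take all vertices as one shore: no edge crosses, while every vertex has odd degree 1 in the
-- matching. Evenness is phrased as the vanishing of `n` copies of any `b`, so that `b` can later be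
-- the parity of an arbitrary regularity `k`.
perfectMatching⇒evenOrder : (G : Graph n m) → HasPerfectMatching G →
                            (b : Bool) → Xor.sum {n} (const b) ≡ false
perfectMatching⇒evenOrder {n = n} G _ false = Xor.sum-replicate-zero n
perfectMatching⇒evenOrder {m = m} G (M , pm) true =
  trans (regular-cut-parity G M pm (const true))
        (trans (Xor.sum-cong-≗ λ e → ∧-zeroʳ (lookup M e)) (Xor.sum-replicate-zero m))

-- Walks and cuts

joins-ends : (G : Graph n m) {e : Fin m} {u v : Fin n} → Joins G e u v →
             (u ≡ proj₁ (ends G e) × v ≡ proj₂ (ends G e)) ⊎
             (u ≡ proj₂ (ends G e) × v ≡ proj₁ (ends G e))
joins-ends G (inj₁ eq) = inj₁ (cong proj₁ (sym eq) , cong proj₂ (sym eq))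
joins-ends G (inj₂ eq) = inj₂ (cong proj₂ (sym eq) , cong proj₁ (sym eq))

-- Along a walk whose ends have different values of `f`, some step changes the value; the induction
-- stops at the first such step.
crossing-edge : (G : Graph n m) {S : Subset m} (f : Fin n → Bool) {u v : Fin n} →
                Star (Adjacent G S) u v → f u ≢ f v →
                ∃[ e ] (e ∈ S × crosses G f e ≡ true)
crossing-edge G f ε fu≢fv = contradiction refl fu≢fv
crossing-edge G f {u} (_◅_ {j = w} (e , e∈S , j) ws) fu≢fv with f u Bool.≟ f w
... | yes fu≡fw = crossing-edge G f ws (fu≢fv ∘ trans fu≡fw)
... | no  fu≢fw = e , e∈S , [ (λ { (refl , refl) → differ fu≢fw })
                            , (λ { (refl , refl) → differ (fu≢fw ∘ sym) }) ]′ (joins-ends G j)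
  where
  differ : ∀ {a b : Bool} → a ≢ b → a xor b ≡ true
  differ {false} {false} a≢b = contradiction refl a≢b
  differ {false} {true}  a≢b = refl
  differ {true}  {false} a≢b = refl
  differ {true}  {true}  a≢b = contradiction refl a≢b

AdjacentAvoiding : (G : Graph n m) → Subset m → Fin m → Fin n → Fin n → Set
AdjacentAvoiding G S e u v = ∃[ i ] (i ≢ e × i ∈ S × Joins G i u v)

∧≡true : ∀ {a b} → a ∧ b ≡ true → a ≡ true × b ≡ true
∧≡true {true} {true} _ = refl , refl

-- Assign to every vertex an end of e it reaches without e.  If the ends of e are not yet joined, e
-- crosses the resulting cut; cuts meet a 2-regular subgraph evenly, so another edge joins the parts.
hamiltonian-bridgeless : (G : Graph n m) (S : Subset m) → HamiltonianCycle G S →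
                         (e : Fin m) → e ∈ S → ∀ u v → Star (AdjacentAvoiding G S e) u v
hamiltonian-bridgeless {n} {suc m} G S (conn , reg) e e∈S u v = to-x u ◅◅ reverse-path (to-x v)
  where
  R = AdjacentAvoiding G S e
  x = proj₁ (ends G e)
  y = proj₂ (ends G e)

  reverse-path : ∀ {a b} → Star R a b → Star R b a
  reverse-path = reverse λ (i , i≢e , i∈S , j) → i , i≢e , i∈S , Sum.swap j

  -- Follow the walk towards `x` up to its first use of `e`; the vertex reached there is an end of
  -- `e`.
  to-end : ∀ {a} → Star (Adjacent G S) a x → Star R a x ⊎ Star R a y
  to-end ε = inj₁ ε
  to-end ((i , i∈S , j) ◅ p) with i ≟ e
  ... | no i≢e = Sum.map ((i , i≢e , i∈S , j) ◅_) ((i , i≢e , i∈S , j) ◅_) (to-end p)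
  ... | yes refl with joins-ends G j
  ...   | inj₁ (refl , _) = inj₁ ε
  ...   | inj₂ (refl , _) = inj₂ ε

  choice : ∀ a → Star R a x ⊎ Star R a y
  choice a = to-end (conn a x)

  isX : ∀ {a} → Star R a x ⊎ Star R a y → Bool
  isX = [ const true , const false ]′

  f : Fin n → Bool
  f a = isX (choice a)

  even-cut : Xor.sum (λ i → lookup S i ∧ crosses G f i) ≡ false
  even-cut = trans (sym (regular-cut-parity G S reg f))
                   (trans (Xor.sum-cong-≗ λ a → ∧-zeroʳ (f a)) (Xor.sum-replicate-zero n))

  -- Equal labels would make the `xor` false, so only the two mixed cases remain.
  join : ∀ {a b} → R a b → (cₐ : Star R a x ⊎ Star R a y) (c_b : Star R b x ⊎ Star R b y) →
         isX cₐ xor isX c_b ≡ true → Star R x y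
  join r (inj₁ p) (inj₂ q) _ = reverse-path p ◅◅ r ◅ q
  join r (inj₂ p) (inj₁ q) _ = reverse-path (reverse-path p ◅◅ r ◅ q)

  x⇝y : Star R x y
  x⇝y with choice x in cx | choice y in cy
  ... | inj₂ p | _      = p
  ... | inj₁ _ | inj₁ q = reverse-path q
  ... | inj₁ _ | inj₂ _ =
    let fx : f x ≡ true
        fx = cong isX cx
        fy : f y ≡ false
        fy = cong isX cy
        rest : Fin m → Bool
        rest i = lookup S (punchIn e i) ∧ crosses G f (punchIn e i)
        -- The term of `e` is `true`, since `e` lies in `S` and crosses; an even total leaves an odd
        -- number of other crossing edges of `S`.
        odd-rest : true xor Xor.sum rest ≡ false
        odd-rest = trans (cong (_xor Xor.sum rest)
                            (sym (cong₂ _∧_ ([]=⇒lookup e∈S) (cong₂ _xor_ fx fy))))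
                         (trans (sym (Xor.sum-remove {i = e} λ i → lookup S i ∧ crosses G f i)) even-cut)
        i , Si∧cross = xor-sum-true⇒∃ rest (not-false odd-rest)
        Si , cross = ∧≡true Si∧cross
    in join (punchIn e i , punchInᵢ≢i e i , lookup⇒[]= _ S Si , inj₁ refl) (choice _) (choice _) cross
    where
    not-false : ∀ {b} → not b ≡ false → b ≡ true
    not-false {true} _ = refl

  to-x : ∀ a → Star R a x
  to-x a = [ id , _◅◅ reverse-path x⇝y ]′ (choice a)

-- Complementary perfect matchings in a 2-regular subgraph

∁-perfectMatching : (G : Graph n m) (H M : Subset m) → Regular 2 G H → M ⊆ H →
                    PerfectMatching G M → PerfectMatching G (H ∩ ∁ M)
-- `M` and `H ∩ ∁ M` partition `H`, so their degrees at `v` add up to 2; cancelling the degree 1 of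
-- `M` leaves 1.
∁-perfectMatching G H M reg M⊆H pm v = +-cancelʳ-≡ 1 _ 1 (begin
  degree G (H ∩ ∁ M) v + 1
    ≡⟨ cong (degree G (H ∩ ∁ M) v +_) (sym (pm v)) ⟩
  degree G (H ∩ ∁ M) v + degree G M v
    ≡⟨ cong₂ _+_ (degree-sum G (H ∩ ∁ M) v) (degree-sum G M v) ⟩
  sum (λ e → ♯ (lookup (H ∩ ∁ M) e ∧ μ e)) + sum (λ e → ♯ (lookup M e ∧ μ e))
    ≡⟨ sym (∑-distrib-+ (λ e → ♯ (lookup (H ∩ ∁ M) e ∧ μ e)) (λ e → ♯ (lookup M e ∧ μ e))) ⟩
  sum (λ e → ♯ (lookup (H ∩ ∁ M) e ∧ μ e) + ♯ (lookup M e ∧ μ e))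
    ≡⟨ sum-cong-≗ pointwise ⟩
  sum (λ e → ♯ (lookup H e ∧ μ e))
    ≡⟨ sym (degree-sum G H v) ⟩
  degree G H v
    ≡⟨ reg v ⟩
  2 ∎)
  where
  open ≡-Reasoning
  μ = λ e → meets (ends G e) v
  bool : ∀ h m b → (m ≡ true → h ≡ true) → ♯ ((h ∧ not m) ∧ b) + ♯ (m ∧ b) ≡ ♯ (h ∧ b)
  bool true  true  b     _ = refl
  bool true  false b     _ = +-identityʳ _
  bool false true  b     h with () ← h refl
  bool false false b     _ = refl
  pointwise : ∀ e → ♯ (lookup (H ∩ ∁ M) e ∧ μ e) + ♯ (lookup M e ∧ μ e) ≡ ♯ (lookup H e ∧ μ e)
  pointwise e rewrite lookup-zipWith _∧_ e H (∁ M) | lookup-map e not M =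
    bool _ _ (μ e) ([]=⇒lookup ∘ M⊆H ∘ lookup⇒[]= e M)

-- `M` and its complement in `H` disagree on every edge of `H`, so one of the two takes the
-- prescribed value at `e`.
perfectMatching-with : (G : Graph n m) (H M : Subset m) → Regular 2 G H → M ⊆ H → PerfectMatching G M →
                       ∀ {e} → e ∈ H → (b : Bool) → ∃[ N ] (PerfectMatching G N × lookup N e ≡ b)
perfectMatching-with G H M reg M⊆H pm {e} e∈H b with lookup M e Bool.≟ b
... | yes eq = M , pm , eq
... | no neq = H ∩ ∁ M , ∁-perfectMatching G H M reg M⊆H pm ,
    trans (lookup-zipWith _∧_ e H (∁ M))
      (trans (cong₂ _∧_ ([]=⇒lookup e∈H) (lookup-map e not M)) (flip neq))
  where
  flip : ∀ {a b} → a ≢ b → not a ≡ b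
  flip {true}  {true}  a≢b = contradiction refl a≢b
  flip {true}  {false} a≢b = refl
  flip {false} {true}  a≢b = refl
  flip {false} {false} a≢b = contradiction refl a≢b

-- The sides of a 2-cut

-- G′ sits in G with e = xy replaced by a connection through the cut edges c (at x) and d (at y);
-- ρ collapses everything beyond the cut to x, so that d becomes e.
record Side (G : Graph N K) (c d : Fin K) (G′ : Graph n (suc m)) (e : Fin (suc m)) (x y : Fin n) : Set where
  field
    joins-e  : Joins G′ e x y
    ι        : Fin n → Fin N
    edge     : Fin m → Fin K
    ρ        : Fin N → Fin n
    ρ-ι      : ∀ v → ρ (ι v) ≡ v
    ends-edge : ∀ i → ends G (edge i) ≡ Product.map ι ι (ends G′ (punchIn e i))
    degree-ι : ∀ S v → degree G S (ι v) ≡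
               ♯ (lookup S c ∧ ⌊ x ≟ v ⌋) + (♯ (lookup S d ∧ ⌊ y ≟ v ⌋) +
                 sum (λ i → ♯ (lookup S (edge i) ∧ meets (ends G′ (punchIn e i)) v)))
    -- In the 2-cut connection the last alternative accounts for `c` and for all edges beyond the
    -- cut, which collapse to `x`.
    project  : ∀ i → (∃[ j ] i ≡ edge j)
                   ⊎ (i ≡ d × Joins G′ e (ρ (proj₁ (ends G i))) (ρ (proj₂ (ends G i))))
                   ⊎ ρ (proj₁ (ends G i)) ≡ ρ (proj₂ (ends G i))

  -- A relation rather than a function, since it is established in both directions: by restricting
  -- an edge set of `G`, and by gluing edge sets of the two sides.
  record Agrees (S : Subset K) (S′ : Subset (suc m)) : Set where
    eta-equality
    constructor agrees
    field
      at-c    : lookup S c ≡ lookup S′ e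
      at-d    : lookup S d ≡ lookup S′ e
      at-edge : ∀ i → lookup S (edge i) ≡ lookup S′ (punchIn e i)

  open Agrees public

  restrict : Subset K → Subset (suc m)
  restrict S = insertAt (tabulate (lookup S ∘ edge)) e (lookup S c)

  restrict-agrees : ∀ S → lookup S c ≡ lookup S d → Agrees S (restrict S)
  restrict-agrees S eq =
    agrees (sym (insertAt-lookup xs e _)) (trans (sym eq) (sym (insertAt-lookup xs e _)))
      λ i → trans (sym (lookup∘tabulate (lookup S ∘ edge) i)) (sym (insertAt-punchIn xs e _ i))
    where xs = tabulate (lookup S ∘ edge)

  private
    meets-e : ∀ v → meets (ends G′ e) v ≡ ⌊ x ≟ v ⌋ ∨ ⌊ y ≟ v ⌋
    meets-e v with joins-e
    ... | inj₁ eq = cong (λ p → meets p v) eq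
    ... | inj₂ eq = trans (cong (λ p → meets p v) eq) (∨-comm ⌊ y ≟ v ⌋ ⌊ x ≟ v ⌋)

    x≢y : x ≢ y
    x≢y x≡y with joins-e
    ... | inj₁ eq = loopless G′ e (trans (cong proj₁ eq) (trans x≡y (cong proj₂ (sym eq))))
    ... | inj₂ eq = loopless G′ e (trans (cong proj₁ eq) (trans (sym x≡y) (cong proj₂ (sym eq))))

    ♯-split : ∀ b v → ♯ (b ∧ ⌊ x ≟ v ⌋) + ♯ (b ∧ ⌊ y ≟ v ⌋) ≡ ♯ (b ∧ (⌊ x ≟ v ⌋ ∨ ⌊ y ≟ v ⌋))
    ♯-split false v = refl
    ♯-split true  v with x ≟ v | y ≟ v
    ... | yes refl | yes refl = contradiction refl x≢y
    ... | yes _    | no _     = refl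
    ... | no _     | yes _    = refl
    ... | no _     | no _     = refl

  -- At a vertex of this side, `c` contributes at `x` and `d` at `y`. As `x` and `y` are distinct,
  -- together they contribute exactly what `e` does in `G′`.
  degree-agrees : ∀ {S S′} → Agrees S S′ → ∀ v → degree G S (ι v) ≡ degree G′ S′ v
  degree-agrees {S} {S′} (agrees c≡ d≡ edge≡) v = begin
    degree G S (ι v)
      ≡⟨ degree-ι S v ⟩
    ♯ (lookup S c ∧ ⌊ x ≟ v ⌋) + (♯ (lookup S d ∧ ⌊ y ≟ v ⌋) +
      sum (λ i → ♯ (lookup S (edge i) ∧ meets (ends G′ (punchIn e i)) v)))
      ≡⟨ cong₂ _+_ (cong (λ b → ♯ (b ∧ ⌊ x ≟ v ⌋)) c≡)
           (cong₂ _+_ (cong (λ b → ♯ (b ∧ ⌊ y ≟ v ⌋)) d≡)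
             (sum-cong-≗ λ i → cong (λ b → ♯ (b ∧ meets (ends G′ (punchIn e i)) v)) (edge≡ i))) ⟩
    ♯ (lookup S′ e ∧ ⌊ x ≟ v ⌋) + (♯ (lookup S′ e ∧ ⌊ y ≟ v ⌋) + rest)
      ≡⟨ sym (+-assoc (♯ (lookup S′ e ∧ ⌊ x ≟ v ⌋)) _ rest) ⟩
    ♯ (lookup S′ e ∧ ⌊ x ≟ v ⌋) + ♯ (lookup S′ e ∧ ⌊ y ≟ v ⌋) + rest
      ≡⟨ cong (_+ rest) (trans (♯-split (lookup S′ e) v)
                               (cong (λ b → ♯ (lookup S′ e ∧ b)) (sym (meets-e v)))) ⟩
    ♯ (lookup S′ e ∧ meets (ends G′ e) v) + rest
      ≡⟨ sym (sum-remove {i = e} λ j → ♯ (lookup S′ j ∧ meets (ends G′ j) v)) ⟩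
    sum (λ j → ♯ (lookup S′ j ∧ meets (ends G′ j) v))
      ≡⟨ sym (degree-sum G′ S′ v) ⟩
    degree G′ S′ v ∎
    where
    open ≡-Reasoning
    rest = sum (λ i → ♯ (lookup S′ (punchIn e i) ∧ meets (ends G′ (punchIn e i)) v))

  regular-restrict : ∀ {S S′} → Agrees S S′ → Regular k G S → Regular k G′ S′
  regular-restrict S~S′ reg v = trans (sym (degree-agrees S~S′ v)) (reg (ι v))

  -- Walks of `G` are pushed forward along `ρ`: each edge becomes an edge of `G′` or disappears by
  -- contraction, and `ρ-ι` restores the endpoints.
  connected-restrict : ∀ {S S′} → Agrees S S′ → ConnectedOn G S → ConnectedOn G′ S′
  connected-restrict {S} {S′} (agrees _ d≡ edge≡) conn u v =
    subst (λ a → Star (Adjacent G′ S′) a v) (ρ-ι u)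
      (subst (Star (Adjacent G′ S′) _) (ρ-ι v) (walk (conn (ι u) (ι v))))
    where
    reverse-walk : ∀ {a b} → Star (Adjacent G′ S′) a b → Star (Adjacent G′ S′) b a
    reverse-walk = reverse λ (i , i∈S , j) → i , i∈S , Sum.swap j

    project-ends : ∀ i → i ∈ S →
                   Star (Adjacent G′ S′) (ρ (proj₁ (ends G i))) (ρ (proj₂ (ends G i)))
    project-ends i i∈S with project i
    ... | inj₁ (j , refl) rewrite ends-edge j =
      (punchIn e j , lookup⇒[]= _ S′ (trans (sym (edge≡ j)) ([]=⇒lookup i∈S)) ,
        inj₁ (cong₂ _,_ (sym (ρ-ι _)) (sym (ρ-ι _)))) ◅ ε
    ... | inj₂ (inj₁ (refl , j)) = (e , lookup⇒[]= _ S′ (trans (sym d≡) ([]=⇒lookup i∈S)) , j) ◅ ε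
    ... | inj₂ (inj₂ eq) = subst (Star (Adjacent G′ S′) _) eq ε

    walk : ∀ {a b} → Star (Adjacent G S) a b → Star (Adjacent G′ S′) (ρ a) (ρ b)
    walk ε = ε
    walk ((i , i∈S , j) ◅ p) with joins-ends G j
    ... | inj₁ (refl , refl) = project-ends i i∈S ◅◅ walk p
    ... | inj₂ (refl , refl) = reverse-walk (project-ends i i∈S) ◅◅ walk p

  -- By `hamiltonian-bridgeless` the walk in `G′` can avoid `e`, the only edge of `G′` without a
  -- copy in `G`.
  connected-lift : ∀ {S S′} → Agrees S S′ → HamiltonianCycle G′ S′ → e ∈ S′ →
                   ∀ u v → Star (Adjacent G S) (ι u) (ι v)
  connected-lift {S} {S′} (agrees _ _ edge≡) ham e∈S′ u v =
    gmap ι lift (hamiltonian-bridgeless G′ S′ ham e e∈S′ u v)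
    where
    lift : ∀ {a b} → AdjacentAvoiding G′ S′ e a b → Adjacent G S (ι a) (ι b)
    lift {a} {b} (i , i≢e , i∈S′ , j) =
      edge i′ , lookup⇒[]= _ S (trans (edge≡ i′) (trans (cong (lookup S′) i′↑) ([]=⇒lookup i∈S′))) ,
      Sum.map lift-ends lift-ends j
      where
      i′ = punchOut (i≢e ∘ sym)
      i′↑ : punchIn e i′ ≡ i
      i′↑ = punchIn-punchOut (i≢e ∘ sym)
      lift-ends : ∀ {p} → ends G′ i ≡ p → ends G (edge i′) ≡ Product.map ι ι p
      lift-ends eq = trans (ends-edge i′) (cong (Product.map ι ι) (trans (cong (ends G′) i′↑) eq))

-- Combining two sides of the same cut

module _ {G : Graph N K} {c d : Fin K}
         {G₁ : Graph n₁ (suc m₁)} {e₁ : Fin (suc m₁)} {x₁ y₁ : Fin n₁}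
         {G₂ : Graph n₂ (suc m₂)} {e₂ : Fin (suc m₂)} {x₂ y₂ : Fin n₂}
         (A : Side G c d G₁ e₁ x₁ y₁) (B : Side G c d G₂ e₂ x₂ y₂) where
  private
    module A = Side A
    module B = Side B

  Covers : Set
  Covers = ∀ v → (∃[ u ] v ≡ A.ι u) ⊎ (∃[ u ] v ≡ B.ι u)

  Glues : Set
  Glues = ∀ S₁ S₂ → lookup S₁ e₁ ≡ lookup S₂ e₂ → ∃[ S ] (A.Agrees S S₁ × B.Agrees S S₂)

  regular-glue : Covers → ∀ {S S₁ S₂} → A.Agrees S S₁ → B.Agrees S S₂ →
                 Regular k G₁ S₁ → Regular k G₂ S₂ → Regular k G S
  regular-glue cover S~S₁ S~S₂ reg₁ reg₂ v with cover v
  ... | inj₁ (u , refl) = trans (A.degree-agrees S~S₁ u) (reg₁ u)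
  ... | inj₂ (u , refl) = trans (B.degree-agrees S~S₂ u) (reg₂ u)

  -- The chosen matching of G₁ is completed on the other side by the trace of a perfect matching
  -- of G that treats the cut in the same way; a Hamiltonian cycle and the complement in it of a
  -- perfect matching provide both kinds.
  PMH⇒extend : Covers → Glues →
               (∀ {k} S → Regular k G S → lookup S c ≡ lookup S d) →
               (∀ H → HamiltonianCycle G H → c ∈ H) →
               PMH G → PMsExtendThrough G₁ e₁
  PMH⇒extend cover glue balanced c∈ ((M₀ , pm₀) , extend) M₁ pm₁ =
    let H₀ , ham₀ , M₀⊆H₀ = extend M₀ pm₀
        N , pmN , Nc = perfectMatching-with G H₀ M₀ (proj₂ ham₀) M₀⊆H₀ pm₀ (c∈ H₀ ham₀) (lookup M₁ e₁)
        N~M₂ = B.restrict-agrees N (balanced N pmN)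
        M , M~M₁ , M~M₂ = glue M₁ (B.restrict N) (trans (sym Nc) (B.at-c N~M₂))
        pm = regular-glue cover M~M₁ M~M₂ pm₁ (B.regular-restrict N~M₂ pmN)
        H , ham , M⊆H = extend M pm
        H~H₁ = A.restrict-agrees H (balanced H (proj₂ ham))
        -- A Hamiltonian cycle of `G` contains `c`, and restriction records this at `e₁`.
        e₁∈H₁ = lookup⇒[]= e₁ (A.restrict H) (trans (sym (A.at-c H~H₁)) ([]=⇒lookup (c∈ H ham)))
    in A.restrict H ,
       (A.connected-restrict H~H₁ (proj₁ ham) , A.regular-restrict H~H₁ (proj₂ ham)) ,
       contained M⊆H M~M₁ H~H₁ e₁∈H₁ , e₁∈H₁
    where
    -- Every edge other than `e₁` has a copy in `G`, where the inclusion of `M` in `H` applies; `e₁`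
    -- itself lies in `H₁` in any case.
    contained : ∀ {M H M₁ H₁} → M ⊆ H → A.Agrees M M₁ → A.Agrees H H₁ → e₁ ∈ H₁ → M₁ ⊆ H₁
    contained {M} {H} {M₁} {H₁} M⊆H M~M₁ H~H₁ e₁∈H₁ {i} i∈M₁ with e₁ ≟ i
    ... | yes refl = e₁∈H₁
    ... | no e₁≢i  = subst (_∈ H₁) (punchIn-punchOut e₁≢i)
      (lookup⇒[]= _ H₁ (trans (sym (A.at-edge H~H₁ i′)) ([]=⇒lookup (M⊆H (lookup⇒[]= _ M
        (trans (A.at-edge M~M₁ i′) (trans (cong (lookup M₁) (punchIn-punchOut e₁≢i)) ([]=⇒lookup i∈M₁))))))))
      where i′ = punchOut e₁≢i

-- The 2-cut connection and its two sides

module TwoCut (G₁ : Graph n₁ (suc m₁)) (e₁ : Fin (suc m₁)) (x₁ y₁ : Fin n₁)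
              (G₂ : Graph n₂ (suc m₂)) (e₂ : Fin (suc m₂)) (x₂ y₂ : Fin n₂)
              (joins₁ : Joins G₁ e₁ x₁ y₁) (joins₂ : Joins G₂ e₂ x₂ y₂) where

  G : Graph (n₁ + n₂) (2 + (m₁ + m₂))
  G = twoCutConnection G₁ e₁ x₁ y₁ G₂ e₂ x₂ y₂

  edgeˡ : Fin m₁ → Fin (2 + (m₁ + m₂))
  edgeˡ i = suc (suc (i ↑ˡ m₂))

  edgeʳ : Fin m₂ → Fin (2 + (m₁ + m₂))
  edgeʳ j = suc (suc (m₁ ↑ʳ j))

  -- Follows the numbering produced by `addEdge` and `⊔`: the two cut edges first, then the
  -- surviving edges of `G₁` and of `G₂`.
  data EdgeView : Fin (2 + (m₁ + m₂)) → Set where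
    x-edge : EdgeView zero
    y-edge : EdgeView (suc zero)
    left   : ∀ i → EdgeView (edgeˡ i)
    right  : ∀ j → EdgeView (edgeʳ j)

  edgeView : ∀ k → EdgeView k
  edgeView zero          = x-edge
  edgeView (suc zero)    = y-edge
  edgeView (suc (suc k)) with splitAt m₁ k in eq
  ... | inj₁ i = subst (λ k → EdgeView (suc (suc k))) (splitAt⁻¹-↑ˡ eq) (left i)
  ... | inj₂ j = subst (λ k → EdgeView (suc (suc k))) (splitAt⁻¹-↑ʳ eq) (right j)

  ends-edgeˡ : ∀ i → ends G (edgeˡ i) ≡ Product.map (_↑ˡ n₂) (_↑ˡ n₂) (ends G₁ (punchIn e₁ i))
  ends-edgeˡ i rewrite splitAt-↑ˡ m₁ i m₂ = refl

  ends-edgeʳ : ∀ j → ends G (edgeʳ j) ≡ Product.map (n₁ ↑ʳ_) (n₁ ↑ʳ_) (ends G₂ (punchIn e₂ j))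
  ends-edgeʳ j rewrite splitAt-↑ʳ m₁ m₂ j = refl

  ⌊ˡ≟ˡ⌋ : ∀ (a b : Fin n₁) → ⌊ a ↑ˡ n₂ ≟ b ↑ˡ n₂ ⌋ ≡ ⌊ a ≟ b ⌋
  ⌊ˡ≟ˡ⌋ = ⌊≟⌋-injective (_↑ˡ n₂) (↑ˡ-injective n₂ _ _)

  ⌊ʳ≟ʳ⌋ : ∀ (a b : Fin n₂) → ⌊ n₁ ↑ʳ a ≟ n₁ ↑ʳ b ⌋ ≡ ⌊ a ≟ b ⌋
  ⌊ʳ≟ʳ⌋ = ⌊≟⌋-injective (n₁ ↑ʳ_) (↑ʳ-injective n₁ _ _)

  ⌊ˡ≟ʳ⌋ : ∀ (a : Fin n₁) (b : Fin n₂) → ⌊ a ↑ˡ n₂ ≟ n₁ ↑ʳ b ⌋ ≡ false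
  ⌊ˡ≟ʳ⌋ a b = ⌊≟⌋-≢ (↑ˡ≢↑ʳ a b)

  ⌊ʳ≟ˡ⌋ : ∀ (a : Fin n₂) (b : Fin n₁) → ⌊ n₁ ↑ʳ a ≟ b ↑ˡ n₂ ⌋ ≡ false
  ⌊ʳ≟ˡ⌋ a b = ⌊≟⌋-≢ (↑ˡ≢↑ʳ b a ∘ sym)

  meets-ˡˡ : ∀ p v → meets (Product.map (_↑ˡ n₂) (_↑ˡ n₂) p) (v ↑ˡ n₂) ≡ meets p v
  meets-ˡˡ (a , b) v = cong₂ _∨_ (⌊ˡ≟ˡ⌋ a v) (⌊ˡ≟ˡ⌋ b v)

  meets-ʳʳ : ∀ p v → meets (Product.map (n₁ ↑ʳ_) (n₁ ↑ʳ_) p) (n₁ ↑ʳ v) ≡ meets p v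
  meets-ʳʳ (a , b) v = cong₂ _∨_ (⌊ʳ≟ʳ⌋ a v) (⌊ʳ≟ʳ⌋ b v)

  meets-ˡʳ : ∀ p v → meets (Product.map (_↑ˡ n₂) (_↑ˡ n₂) p) (n₁ ↑ʳ v) ≡ false
  meets-ˡʳ (a , b) v = cong₂ _∨_ (⌊ˡ≟ʳ⌋ a v) (⌊ˡ≟ʳ⌋ b v)

  meets-ʳˡ : ∀ p v → meets (Product.map (n₁ ↑ʳ_) (n₁ ↑ʳ_) p) (v ↑ˡ n₂) ≡ false
  meets-ʳˡ (a , b) v = cong₂ _∨_ (⌊ʳ≟ˡ⌋ a v) (⌊ʳ≟ˡ⌋ b v)

  degree-splitAt : ∀ S v → degree G S v ≡
    ♯ (lookup S zero ∧ meets (x₁ ↑ˡ n₂ , n₁ ↑ʳ x₂) v) +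
    (♯ (lookup S (suc zero) ∧ meets (y₁ ↑ˡ n₂ , n₁ ↑ʳ y₂) v) +
     (sum (λ i → ♯ (lookup S (edgeˡ i) ∧ meets (Product.map (_↑ˡ n₂) (_↑ˡ n₂) (ends G₁ (punchIn e₁ i))) v)) +
      sum (λ j → ♯ (lookup S (edgeʳ j) ∧ meets (Product.map (n₁ ↑ʳ_) (n₁ ↑ʳ_) (ends G₂ (punchIn e₂ j))) v))))
  degree-splitAt S v = trans (degree-sum G S v)
    (cong (λ s → ♯ (lookup S zero ∧ meets (x₁ ↑ˡ n₂ , n₁ ↑ʳ x₂) v) +
                 (♯ (lookup S (suc zero) ∧ meets (y₁ ↑ˡ n₂ , n₁ ↑ʳ y₂) v) + s))
      (trans (sum-splitAt (CommutativeMonoid.monoid +-0-commutativeMonoid) m₁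
                (λ k → ♯ (lookup S (suc (suc k)) ∧ meets (ends G (suc (suc k))) v)))
             (cong₂ _+_
               (sum-cong-≗ λ i → cong (λ p → ♯ (lookup S (edgeˡ i) ∧ meets p v)) (ends-edgeˡ i))
               (sum-cong-≗ λ j → cong (λ p → ♯ (lookup S (edgeʳ j) ∧ meets p v)) (ends-edgeʳ j)))))

  -- Removes from a degree the edges of the opposite graph, none of which meets the vertex.
  sum-∧-false : (s t : Fin m → Bool) → (∀ i → t i ≡ false) → sum (λ i → ♯ (s i ∧ t i)) ≡ 0
  sum-∧-false {m} s t t≡ =
    trans (sum-cong-≗ λ i → cong ♯ (trans (cong (s i ∧_) (t≡ i)) (∧-zeroʳ (s i))))
          (sum-replicate-zero m)

  side₁ : Side G zero (suc zero) G₁ e₁ x₁ y₁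
  side₁ = record
    { joins-e   = joins₁
    ; ι         = _↑ˡ n₂
    ; edge      = edgeˡ
    ; ρ         = ρ
    ; ρ-ι       = ρ-ι
    ; ends-edge = ends-edgeˡ
    ; degree-ι  = λ S v → trans (degree-splitAt S (v ↑ˡ n₂))
        (cong₂ _+_ (cong (λ b → ♯ (lookup S zero ∧ b)) (cut x₁ x₂ v))
          (cong₂ _+_ (cong (λ b → ♯ (lookup S (suc zero) ∧ b)) (cut y₁ y₂ v))
            (trans (cong₂ _+_
                     (sum-cong-≗ λ i → cong (λ b → ♯ (lookup S (edgeˡ i) ∧ b))
                                            (meets-ˡˡ (ends G₁ (punchIn e₁ i)) v))
                     (sum-∧-false (lookup S ∘ edgeʳ) _ λ j → meets-ʳˡ (ends G₂ (punchIn e₂ j)) v))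
                   (+-identityʳ _))))
    ; project   = λ k → project (edgeView k)
    }
    where
    ρ : Fin (n₁ + n₂) → Fin n₁
    ρ v = [ id , const x₁ ]′ (splitAt n₁ v)

    ρ-ι : ∀ v → ρ (v ↑ˡ n₂) ≡ v
    ρ-ι v = cong [ id , const x₁ ]′ (splitAt-↑ˡ n₁ v n₂)

    ρ-ʳ : ∀ v → ρ (n₁ ↑ʳ v) ≡ x₁
    ρ-ʳ v = cong [ id , const x₁ ]′ (splitAt-↑ʳ n₁ n₂ v)

    cut : ∀ a b v → meets (a ↑ˡ n₂ , n₁ ↑ʳ b) (v ↑ˡ n₂) ≡ ⌊ a ≟ v ⌋
    cut a b v = trans (cong₂ _∨_ (⌊ˡ≟ˡ⌋ a v) (⌊ʳ≟ˡ⌋ b v)) (∨-identityʳ _)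

    project : ∀ {k} → EdgeView k → (∃[ j ] k ≡ edgeˡ j)
            ⊎ (k ≡ suc zero × Joins G₁ e₁ (ρ (proj₁ (ends G k))) (ρ (proj₂ (ends G k))))
            ⊎ ρ (proj₁ (ends G k)) ≡ ρ (proj₂ (ends G k))
    project x-edge    = inj₂ (inj₂ (trans (ρ-ι x₁) (sym (ρ-ʳ x₂))))
    -- The right end collapses to `x₁`, so the image runs from `y₁` to `x₁`, opposite to `joins₁`.
    project y-edge    rewrite ρ-ι y₁ | ρ-ʳ y₂ = inj₂ (inj₁ (refl , Sum.swap joins₁))
    project (left i)  = inj₁ (i , refl)
    project (right j) rewrite ends-edgeʳ j = inj₂ (inj₂ (trans (ρ-ʳ _) (sym (ρ-ʳ _))))

  side₂ : Side G zero (suc zero) G₂ e₂ x₂ y₂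
  side₂ = record
    { joins-e   = joins₂
    ; ι         = n₁ ↑ʳ_
    ; edge      = edgeʳ
    ; ρ         = ρ
    ; ρ-ι       = ρ-ι
    ; ends-edge = ends-edgeʳ
    ; degree-ι  = λ S v → trans (degree-splitAt S (n₁ ↑ʳ v))
        (cong₂ _+_ (cong (λ b → ♯ (lookup S zero ∧ b)) (cut x₁ x₂ v))
          (cong₂ _+_ (cong (λ b → ♯ (lookup S (suc zero) ∧ b)) (cut y₁ y₂ v))
            (cong₂ _+_
              (sum-∧-false (lookup S ∘ edgeˡ) _ λ i → meets-ˡʳ (ends G₁ (punchIn e₁ i)) v)
              (sum-cong-≗ λ j → cong (λ b → ♯ (lookup S (edgeʳ j) ∧ b))
                                     (meets-ʳʳ (ends G₂ (punchIn e₂ j)) v)))))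
    ; project   = λ k → project (edgeView k)
    }
    where
    ρ : Fin (n₁ + n₂) → Fin n₂
    ρ v = [ const x₂ , id ]′ (splitAt n₁ v)

    ρ-ι : ∀ v → ρ (n₁ ↑ʳ v) ≡ v
    ρ-ι v = cong [ const x₂ , id ]′ (splitAt-↑ʳ n₁ n₂ v)

    ρ-ˡ : ∀ v → ρ (v ↑ˡ n₂) ≡ x₂
    ρ-ˡ v = cong [ const x₂ , id ]′ (splitAt-↑ˡ n₁ v n₂)

    cut : ∀ a b v → meets (a ↑ˡ n₂ , n₁ ↑ʳ b) (n₁ ↑ʳ v) ≡ ⌊ b ≟ v ⌋
    cut a b v = cong₂ _∨_ (⌊ˡ≟ʳ⌋ a v) (⌊ʳ≟ʳ⌋ b v)

    project : ∀ {k} → EdgeView k → (∃[ j ] k ≡ edgeʳ j)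
            ⊎ (k ≡ suc zero × Joins G₂ e₂ (ρ (proj₁ (ends G k))) (ρ (proj₂ (ends G k))))
            ⊎ ρ (proj₁ (ends G k)) ≡ ρ (proj₂ (ends G k))
    project x-edge    = inj₂ (inj₂ (trans (ρ-ˡ x₁) (sym (ρ-ι x₂))))
    project y-edge    rewrite ρ-ˡ y₁ | ρ-ι y₂ = inj₂ (inj₁ (refl , joins₂))
    project (left i)  rewrite ends-edgeˡ i = inj₂ (inj₂ (trans (ρ-ˡ _) (sym (ρ-ˡ _))))
    project (right j) = inj₁ (j , refl)

  module A = Side side₁
  module B = Side side₂

  covers : Covers side₁ side₂
  covers v with splitAt n₁ v in eq
  ... | inj₁ u = inj₁ (u , sym (splitAt⁻¹-↑ˡ eq))
  ... | inj₂ u = inj₂ (u , sym (splitAt⁻¹-↑ʳ eq))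

  glue : Glues side₁ side₂
  -- Both cut edges receive the common value of `S₁` at `e₁` and of `S₂` at `e₂`.
  glue S₁ S₂ eq = lookup S₁ e₁ ∷ lookup S₁ e₁ ∷ (T₁ ++ T₂) ,
    A.agrees refl refl (λ i → trans (lookup-++ˡ T₁ T₂ i) (lookup∘tabulate _ i)) ,
    B.agrees eq eq (λ j → trans (lookup-++ʳ T₁ T₂ j) (lookup∘tabulate _ j))
    where
    T₁ = tabulate (lookup S₁ ∘ punchIn e₁)
    T₂ = tabulate (lookup S₂ ∘ punchIn e₂)

  -- Regular subgraphs and the 2-cut

  onLeft : Fin (n₁ + n₂) → Bool
  onLeft v = [ const true , const false ]′ (splitAt n₁ v)

  onLeft-ˡ : ∀ v → onLeft (v ↑ˡ n₂) ≡ true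
  onLeft-ˡ v = cong [ const true , const false ]′ (splitAt-↑ˡ n₁ v n₂)

  onLeft-ʳ : ∀ v → onLeft (n₁ ↑ʳ v) ≡ false
  onLeft-ʳ v = cong [ const true , const false ]′ (splitAt-↑ʳ n₁ n₂ v)

  crosses-edgeˡ : ∀ i → crosses G onLeft (edgeˡ i) ≡ false
  crosses-edgeˡ i rewrite ends-edgeˡ i = cong₂ _xor_ (onLeft-ˡ _) (onLeft-ˡ _)

  crosses-edgeʳ : ∀ j → crosses G onLeft (edgeʳ j) ≡ false
  crosses-edgeʳ j rewrite ends-edgeʳ j = cong₂ _xor_ (onLeft-ʳ _) (onLeft-ʳ _)

  crosses-rest : ∀ k → crosses G onLeft (suc (suc k)) ≡ false
  crosses-rest k = go (edgeView (suc (suc k)))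
    where
    go : ∀ {k} → EdgeView (suc (suc k)) → crosses G onLeft (suc (suc k)) ≡ false
    go (left i)  = crosses-edgeˡ i
    go (right j) = crosses-edgeʳ j

  -- Only the two cut edges cross the shore `onLeft`, and the degree sum over that shore is `k`
  -- times the order of `G₁`, which is even. Leaving `k` free covers perfect matchings and
  -- Hamiltonian cycles alike.
  balanced : HasPerfectMatching G₁ → ∀ S → Regular k G S → lookup S zero ≡ lookup S (suc zero)
  balanced {k} pm₁ S reg = xor≡false (begin
    lookup S zero xor lookup S (suc zero)
      -- `Xor.sum` unfolds to the terms of the two cut edges followed by the remaining sum, so the
      -- vanishing remainder is appended as `false`.
      ≡⟨ cong₂ _xor_ (cut-edge (lookup S zero) x₁ x₂)
           (trans (cut-edge (lookup S (suc zero)) y₁ y₂)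
             (trans (sym (xor-identityʳ yb)) (cong (yb xor_) (sym rest≡false)))) ⟩
    Xor.sum (λ e → lookup S e ∧ crosses G onLeft e)
      ≡⟨ sym (regular-cut-parity G S reg onLeft) ⟩
    Xor.sum (λ v → onLeft v ∧ odd k)
      ≡⟨ sum-splitAt (CommutativeRing.+-monoid xor-∧-commutativeRing) n₁ (λ v → onLeft v ∧ odd k) ⟩
    Xor.sum (λ v → onLeft (v ↑ˡ n₂) ∧ odd k) xor Xor.sum (λ v → onLeft (n₁ ↑ʳ v) ∧ odd k)
      ≡⟨ cong₂ _xor_ (trans (Xor.sum-cong-≗ λ v → cong (_∧ odd k) (onLeft-ˡ v))
                            (perfectMatching⇒evenOrder G₁ pm₁ (odd k)))
                     (trans (Xor.sum-cong-≗ λ v → cong (_∧ odd k) (onLeft-ʳ v))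
                            (Xor.sum-replicate-zero n₂)) ⟩
    false ∎)
    where
    open ≡-Reasoning
    yb = lookup S (suc zero) ∧ (onLeft (y₁ ↑ˡ n₂) xor onLeft (n₁ ↑ʳ y₂))

    xor≡false : ∀ {a b} → a xor b ≡ false → a ≡ b
    xor≡false {true}  {true}  _ = refl
    xor≡false {false} {false} _ = refl

    cut-edge : ∀ b u v → b ≡ b ∧ (onLeft (u ↑ˡ n₂) xor onLeft (n₁ ↑ʳ v))
    cut-edge b u v = sym (trans (cong (b ∧_) (cong₂ _xor_ (onLeft-ˡ u) (onLeft-ʳ v))) (∧-identityʳ b))

    rest≡false : Xor.sum (λ e → lookup S (suc (suc e)) ∧ crosses G onLeft (suc (suc e))) ≡ false
    rest≡false =
      trans (Xor.sum-cong-≗ λ e → trans (cong (lookup S (suc (suc e)) ∧_) (crosses-rest e)) (∧-zeroʳ _))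
            (Xor.sum-replicate-zero (m₁ + m₂))

  -- Connectedness forces some edge across the cut; if it is the second cut edge, `balanced`
  -- supplies the first.
  hamiltonian-uses-cut : HasPerfectMatching G₁ → ∀ H → HamiltonianCycle G H → zero ∈ H
  hamiltonian-uses-cut pm₁ H (conn , reg)
    with crossing-edge G onLeft (conn (x₁ ↑ˡ n₂) (n₁ ↑ʳ x₂)) sides-differ
    where
    sides-differ : onLeft (x₁ ↑ˡ n₂) ≢ onLeft (n₁ ↑ʳ x₂)
    sides-differ eq with () ← trans (sym (onLeft-ˡ x₁)) (trans eq (onLeft-ʳ x₂))
  ... | zero        , e∈H , _     = e∈H
  ... | suc zero    , e∈H , _     = lookup⇒[]= zero H (trans (balanced pm₁ H reg) ([]=⇒lookup e∈H))
  ... | suc (suc k) , e∈H , cross with () ← trans (sym cross) (crosses-rest k)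

  -- Every vertex is connected to `x₁`: from the left inside its own side, from the right through
  -- `x₂` and the first cut edge, which belongs to `H` because `e₁` is in `H₁`.
  hamiltonian-glue : ∀ {H H₁ H₂} → A.Agrees H H₁ → B.Agrees H H₂ →
                     HamiltonianCycle G₁ H₁ → e₁ ∈ H₁ → HamiltonianCycle G₂ H₂ → e₂ ∈ H₂ →
                     HamiltonianCycle G H
  hamiltonian-glue {H} {H₁} H~H₁ H~H₂ ham₁ e₁∈H₁ ham₂ e₂∈H₂ =
    (λ u v → to-x u ◅◅ reverse (λ (i , i∈H , j) → i , i∈H , Sum.swap j) (to-x v)) ,
    regular-glue side₁ side₂ covers H~H₁ H~H₂ (proj₂ ham₁) (proj₂ ham₂)
    where
    x-edge∈H : zero ∈ H
    x-edge∈H = lookup⇒[]= zero H (trans (A.at-c H~H₁) ([]=⇒lookup e₁∈H₁))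

    to-x : ∀ v → Star (Adjacent G H) v (x₁ ↑ˡ n₂)
    to-x v with covers v
    ... | inj₁ (u , refl) = A.connected-lift H~H₁ ham₁ e₁∈H₁ u x₁
    ... | inj₂ (u , refl) =
      B.connected-lift H~H₂ ham₂ e₂∈H₂ u x₂ ◅◅ (zero , x-edge∈H , inj₂ refl) ◅ ε

  extend⇒PMH : HasPerfectMatching G₁ → HasPerfectMatching G₂ →
               PMsExtendThrough G₁ e₁ → PMsExtendThrough G₂ e₂ → PMH G
  extend⇒PMH (L₁ , pmL₁) (L₂ , pmL₂) extend₁ extend₂ = has-pm , extend
    where
    has-pm : HasPerfectMatching G
    has-pm =
      let H₁ , ham₁ , L₁⊆H₁ , e₁∈H₁ = extend₁ L₁ pmL₁
          H₂ , ham₂ , L₂⊆H₂ , e₂∈H₂ = extend₂ L₂ pmL₂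
          -- The value `true` is an arbitrary choice: gluing asks only that the two matchings agree
          -- on `e₁` and `e₂`.
          N₁ , pmN₁ , N₁e₁ = perfectMatching-with G₁ H₁ L₁ (proj₂ ham₁) L₁⊆H₁ pmL₁ e₁∈H₁ true
          N₂ , pmN₂ , N₂e₂ = perfectMatching-with G₂ H₂ L₂ (proj₂ ham₂) L₂⊆H₂ pmL₂ e₂∈H₂ true
          N , N~N₁ , N~N₂ = glue N₁ N₂ (trans N₁e₁ (sym N₂e₂))
      in N , regular-glue side₁ side₂ covers N~N₁ N~N₂ pmN₁ pmN₂

    extend : ∀ M → PerfectMatching G M → ∃[ H ] (HamiltonianCycle G H × M ⊆ H)
    extend M pm =
      let bal = balanced (L₁ , pmL₁) M pm
          M~M₁ = A.restrict-agrees M bal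
          M~M₂ = B.restrict-agrees M bal
          H₁ , ham₁ , M₁⊆H₁ , e₁∈H₁ = extend₁ (A.restrict M) (A.regular-restrict M~M₁ pm)
          H₂ , ham₂ , M₂⊆H₂ , e₂∈H₂ = extend₂ (B.restrict M) (B.regular-restrict M~M₂ pm)
          -- The two cycles contain `e₁` and `e₂` respectively, hence agree there and can be glued.
          H , H~H₁ , H~H₂ = glue H₁ H₂ (trans ([]=⇒lookup e₁∈H₁) (sym ([]=⇒lookup e₂∈H₂)))
      in H , hamiltonian-glue H~H₁ H~H₂ ham₁ e₁∈H₁ ham₂ e₂∈H₂ ,
         λ {k} → contained M~M₁ M~M₂ H~H₁ H~H₂ M₁⊆H₁ M₂⊆H₂ (edgeView k)
      where
      along : ∀ {a b} {p q : Subset a} {r s : Subset b} {i j} →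
              lookup p i ≡ lookup r j → lookup q i ≡ lookup s j → r ⊆ s → i ∈ p → i ∈ q
      along {p = p} {q} {r} {s} {i} {j} p≡r q≡s r⊆s i∈p =
        lookup⇒[]= i q (trans q≡s ([]=⇒lookup (r⊆s (lookup⇒[]= j r (trans (sym p≡r) ([]=⇒lookup i∈p))))))

      contained : ∀ {H M₁ H₁ M₂ H₂} → A.Agrees M M₁ → B.Agrees M M₂ → A.Agrees H H₁ → B.Agrees H H₂ →
                  M₁ ⊆ H₁ → M₂ ⊆ H₂ → ∀ {k} → EdgeView k → k ∈ M → k ∈ H
      contained {H} {M₁} {H₁} {M₂} {H₂} M~M₁ M~M₂ H~H₁ H~H₂ ⊆₁ ⊆₂ = λ where
        x-edge    → along {p = M} {H} {M₁} {H₁} (A.at-c M~M₁) (A.at-c H~H₁) ⊆₁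
        y-edge    → along {p = M} {H} {M₁} {H₁} (A.at-d M~M₁) (A.at-d H~H₁) ⊆₁
        (left i)  → along {p = M} {H} {M₁} {H₁} (A.at-edge M~M₁ i) (A.at-edge H~H₁ i) ⊆₁
        (right j) → along {p = M} {H} {M₂} {H₂} (B.at-edge M~M₂ j) (B.at-edge H~H₂ j) ⊆₂

  PMH⇔extend : HasPerfectMatching G₁ → HasPerfectMatching G₂ →
               PMH G ⇔ (PMsExtendThrough G₁ e₁ × PMsExtendThrough G₂ e₂)
  PMH⇔extend pm₁ pm₂ = mk⇔
    (λ pmh →
      PMH⇒extend side₁ side₂ covers glue (balanced pm₁) (hamiltonian-uses-cut pm₁) pmh ,
      -- The same argument with the sides exchanged; only the covering and the gluing have to be
      -- mirrored.
      PMH⇒extend side₂ side₁ (Sum.swap ∘ covers)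
        (λ S₂ S₁ eq → Product.map id Product.swap (glue S₁ S₂ (sym eq)))
        (balanced pm₁) (hamiltonian-uses-cut pm₁) pmh)
    (λ (extend₁ , extend₂) → extend⇒PMH pm₁ pm₂ extend₁ extend₂)

theorem4p1 : ∀ {n₁ m₁ n₂ m₂ : ℕ}
    (G₁ : Graph n₁ (suc m₁)) (G₂ : Graph n₂ (suc m₂)) →
    Connected G₁ → Connected G₂ →
    HasPerfectMatching G₁ → HasPerfectMatching G₂ →
    (e₁ : Fin (suc m₁)) (e₂ : Fin (suc m₂)) →
    ∀ (x₁ y₁ : Fin n₁) (x₂ y₂ : Fin n₂) →
    Joins G₁ e₁ x₁ y₁ → Joins G₂ e₂ x₂ y₂ →
    PMH (twoCutConnection G₁ e₁ x₁ y₁ G₂ e₂ x₂ y₂)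
    ⇔ (PMsExtendThrough G₁ e₁ × PMsExtendThrough G₂ e₂)
theorem4p1 G₁ G₂ _ _ pm₁ pm₂ e₁ e₂ x₁ y₁ x₂ y₂ joins₁ joins₂ =
  TwoCut.PMH⇔extend G₁ e₁ x₁ y₁ G₂ e₂ x₂ y₂ joins₁ joins₂ pm₁ pm₂
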